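{- For all positive integers $n,m$, the second player wins the Peaceable Knights Game $\mathrm{PN}(n,m)$ if and only if at least one of $n$ and $m$ is even.
   Context: The Peaceable Knights Game $\mathrm{PN}(n,m)$ is played on an $n\times m$ chessboard with squares $(x,y)$, $0\leq x\leq n-1$, $0\leq y\leq m-1$. Two players alternately place a knight on an unoccupied square; the first player places white knights and the second player places black knights. A player may not place a knight on a square within attacking range of a knight previously placed by the opponent. A player unable to move on their turn loses. Two squares $(x_1,y_1)$ and $(x_2,y_2)$ are within attacking range for knights iff either $x_2=x_1\pm1$ and $y_2=y_1\pm2$, or $x_2=x_1\pm2$ and $y_2=y_1\pm1$ (signs independent). A player "wins" the game if that player has a winning strategy. -}

module Defs where

open import Data.Bool.Base using (if_then_else_)
open import Data.Fin.Base using (Fin; toℕ)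
import Data.Fin.Properties as Fin
open import Data.Maybe.Base using (Maybe; just; nothing)
open import Data.Nat.Base using (ℕ; _+_)
open import Data.Product.Base using (_×_; _,_)
open import Data.Product.Properties using (≡-dec)
open import Data.Sum.Base using (_⊎_)
open import Relation.Binary.Definitions using (DecidableEquality)
open import Relation.Binary.PropositionalEquality.Core using (_≡_)
open import Relation.Nullary.Decidable.Core using (does)
open import Relation.Nullary.Negation.Core using (¬_)

-- The first player is white, the second player is black.
data Player : Set where
  white black : Player

opponent : Player → Player
opponent white = black
opponent black = white

Square : ℕ → ℕ → Set
Square n m = Fin n × Fin m

_≟□_ : ∀ {n m} → DecidableEquality (Square n m)
_≟□_ = ≡-dec Fin._≟_ Fin._≟_

-- b = a ± d, with b = a - d written as a = b + d to avoid truncated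
-- subtraction.
_≡_±_ : ℕ → ℕ → ℕ → Set
b ≡ a ± d = (b ≡ a + d) ⊎ (a ≡ b + d)

Attacks : ∀ {n m} → Square n m → Square n m → Set
Attacks (x₁ , y₁) (x₂ , y₂) =
    ((toℕ x₂ ≡ toℕ x₁ ± 1) × (toℕ y₂ ≡ toℕ y₁ ± 2))
  ⊎ ((toℕ x₂ ≡ toℕ x₁ ± 2) × (toℕ y₂ ≡ toℕ y₁ ± 1))

-- The owner of the knight on each square, or nothing if it is unoccupied.
Board : ℕ → ℕ → Set
Board n m = Square n m → Maybe Player

emptyBoard : ∀ {n m} → Board n m
emptyBoard _ = nothing

place : ∀ {n m} → Player → Square n m → Board n m → Board n m
place p s b t = if does (s ≟□ t) then just p else b t

Legal : ∀ {n m} → Player → Board n m → Square n m → Set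
Legal p b s =
  (b s ≡ nothing) × (∀ t → b t ≡ just (opponent p) → ¬ Attacks t s)

-- Winning strategies for player p, as well-founded strategy trees:
-- WinsToMove p b is for p to move on b, WinsToReply p b for the opponent
-- of p to move on b.  A player with no legal move loses: WinsToMove p b is
-- then uninhabited and WinsToReply (opponent p) b holds vacuously.
mutual
  data WinsToMove {n m : ℕ} (p : Player) (b : Board n m) : Set where
    move : ∀ s → Legal p b s → WinsToReply p (place p s b) → WinsToMove p b

  data WinsToReply {n m : ℕ} (p : Player) (b : Board n m) : Set where
    reply : (∀ s → Legal (opponent p) b s →
               WinsToMove p (place (opponent p) s b)) →
            WinsToReply p b

-- White moves first, so black is the one replying on the empty board.
SecondPlayerWins : ℕ → ℕ → Set
SecondPlayerWins n m = WinsToReply black (emptyBoard {n} {m})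

{-# OPTIONS --safe #-}

-- Mirroring: if σ is an involution of the board that preserves attacks and
-- never maps a square to one it attacks, then a player who answers every s
-- by σ s always has a legal reply, provided the fixed squares of σ are
-- occupied.  If a side is even, black reflects in that side, which fixes
-- nothing.  If both sides are odd, white takes the centre and then uses the
-- half-turn.
module Submission where

open import Defs
open import Data.Empty using (⊥; ⊥-elim)
open import Data.Fin.Base using (Fin; zero; suc; toℕ; inject₁; opposite)
open import Data.Fin.Properties
  using (toℕ<n; toℕ-injective; toℕ-inject₁; opposite-prop; opposite-involutive)
open import Data.List.Base using (List; length; filter; allFin; cartesianProduct)
open import Data.List.Membership.Propositional using (_∈_; lose)
open import Data.List.Membership.Propositional.Properties
  using (∈-filter⁺; ∈-allFin; ∈-cartesianProduct⁺)
open import Data.List.Properties using (filter-notAll)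
open import Data.Maybe.Base using (just; nothing)
open import Data.Maybe.Properties using (just-injective)
open import Data.Nat.Base using (ℕ; zero; suc; _+_; _*_; _<_; NonZero)
open import Data.Nat.Divisibility
  using (_∣_; divides; _∣0; ∣-refl; ∣1⇒≡1; ∣m∣n⇒∣m+n; ∣m+n∣m⇒∣n; m∣m*n)
open import Data.Nat.Induction using (<-wellFounded)
open import Data.Nat.Properties
  using (+-suc; +-cancelˡ-≡; +-cancelʳ-≡; *-cancelˡ-≡; suc-injective;
         m≢1+m+n; m+[n∸m]≡n)
open import Data.Nat.Tactic.RingSolver using (solve-∀)
open import Data.Product.Base using (∃; _×_; _,_; proj₁; proj₂; map)
open import Data.Sum.Base using (_⊎_; inj₁; inj₂)
open import Function.Base using (id; _∘_)
open import Function.Bundles using (_⇔_; mk⇔)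
open import Induction.WellFounded using (Acc; acc)
open import Relation.Binary.PropositionalEquality
  using (_≡_; _≢_; refl; sym; trans; cong; cong₂; subst; module ≡-Reasoning)
open import Relation.Nullary.Decidable.Core using (yes; no; ¬?)
open import Relation.Nullary.Negation.Core using (¬_; contradiction)

-- Players, placements and the incompatibility of winning strategies.

opponent-involutive : ∀ p → opponent (opponent p) ≡ p
opponent-involutive white = refl
opponent-involutive black = refl

p≢opponent : ∀ p → p ≢ opponent p
p≢opponent white ()
p≢opponent black ()

private variable n m : ℕ

place-same : ∀ p (s : Square n m) b → place p s b s ≡ just p
place-same p s b with s ≟□ s
... | yes _  = refl
... | no s≢s = contradiction refl s≢s

place-other : ∀ p {s t : Square n m} b → s ≢ t → place p s b t ≡ b t
place-other p {s} {t} b s≢t with s ≟□ t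
... | yes s≡t = contradiction s≡t s≢t
... | no _    = refl

place-nothing⁻ : ∀ p (s t : Square n m) b → place p s b t ≡ nothing →
                 s ≢ t × b t ≡ nothing
place-nothing⁻ p s t b eq with s ≟□ t
... | no s≢t = s≢t , eq

place-just⁻ : ∀ p {q} (s t : Square n m) b → place p s b t ≡ just q →
              (s ≡ t × p ≡ q) ⊎ (s ≢ t × b t ≡ just q)
place-just⁻ p s t b eq with s ≟□ t
... | yes s≡t = inj₁ (s≡t , just-injective eq)
... | no s≢t  = inj₂ (s≢t , eq)

-- The two strategies are played against each other: every move passes to subtrees with the roles
-- exchanged, and well-founded trees cannot sustain this forever. Splitting on `p` lets
-- `opponent (opponent p)` reduce.
exclusive : ∀ p {b : Board n m} → WinsToMove p b → WinsToReply (opponent p) b → ⊥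
exclusive white (move s l w) (reply f) = exclusive black (f s l) w
exclusive black (move s l w) (reply f) = exclusive white (f s l) w

-- The mirroring strategy for an abstract involution.

module Mirroring
  (σ : Square n m → Square n m)
  (σ-involutive : ∀ s → σ (σ s) ≡ s)
  (σ-attacks : ∀ s t → Attacks s t → Attacks (σ s) (σ t))
  (σ-peaceful : ∀ s → ¬ Attacks s (σ s))
  where

  -- The invariant of positions with the opponent of `p` to move. `answered` goes in one direction
  -- only, because a knight of `p` may be its own image, as at the centre. `fixed` ensures that a
  -- move never coincides with its mirror reply.
  record Mirrored (p : Player) (b : Board n m) : Set where
    field
      empty    : ∀ t → b t ≡ nothing → b (σ t) ≡ nothing
      answered : ∀ t → b t ≡ just (opponent p) → b (σ t) ≡ just p
      fixed    : ∀ t → σ t ≡ t → b t ≢ nothing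

  σ-injective : ∀ {s t} → σ s ≡ σ t → s ≡ t
  σ-injective {s} {t} eq =
    trans (sym (σ-involutive s)) (trans (cong σ eq) (σ-involutive t))

  module Round (p : Player) (b : Board n m) (inv : Mirrored p b)
               (s : Square n m) (legal : Legal (opponent p) b s) where
    open Mirrored inv

    b₁ b₂ : Board n m
    b₁ = place (opponent p) s b
    b₂ = place p (σ s) b₁

    s≢σs : s ≢ σ s
    s≢σs eq = fixed s (sym eq) (proj₁ legal)

    mirror-legal : Legal p b₁ (σ s)
    mirror-legal =
        trans (place-other _ b s≢σs) (empty s (proj₁ legal))
      , unattacked
      where
      unattacked : ∀ t → b₁ t ≡ just (opponent p) → ¬ Attacks t (σ s)
      unattacked t eq att with place-just⁻ _ s t b eq
      ... | inj₁ (refl , _) = σ-peaceful s att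
      -- An older enemy knight at `t` attacking `σ s` has its image at `σ t` owned by `p`; that
      -- knight attacks `s`, so the move to `s` was illegal.
      ... | inj₂ (_ , bt)   = proj₂ legal (σ t)
        (trans (answered t bt) (cong just (sym (opponent-involutive p))))
        (subst (Attacks (σ t)) (σ-involutive s) (σ-attacks t (σ s) att))

    nothing₂⁻ : ∀ t → b₂ t ≡ nothing → σ s ≢ t × s ≢ t × b t ≡ nothing
    nothing₂⁻ t eq with place-nothing⁻ p (σ s) t b₁ eq
    ... | σs≢t , eq₁ = σs≢t , place-nothing⁻ _ s t b eq₁

    mirrored : Mirrored p b₂
    mirrored = record { empty = empty₂ ; answered = answered₂ ; fixed = fixed₂ }
      where
      empty₂ : ∀ t → b₂ t ≡ nothing → b₂ (σ t) ≡ nothing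
      empty₂ t eq with nothing₂⁻ t eq
      -- Since `t` avoids both new squares `s` and `σ s`, which `σ` exchanges, so does `σ t`.
      ... | σs≢t , s≢t , bt =
        trans (place-other p b₁ (s≢t ∘ σ-injective))
        (trans (place-other _ b λ s≡σt →
                  σs≢t (trans (cong σ s≡σt) (σ-involutive t)))
               (empty t bt))

      answered₂ : ∀ t → b₂ t ≡ just (opponent p) → b₂ (σ t) ≡ just p
      answered₂ t eq with place-just⁻ p (σ s) t b₁ eq
      ... | inj₁ (_ , p≡p′) = contradiction p≡p′ (p≢opponent p)
      ... | inj₂ (_ , eq₁) with place-just⁻ _ s t b eq₁
      ... | inj₁ (refl , _) = place-same p (σ s) b₁
      ... | inj₂ (s≢t , bt) =
        trans (place-other p b₁ (s≢t ∘ σ-injective))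
        (trans (place-other _ b s≢σt) (answered t bt))
        where
        s≢σt : s ≢ σ t
        s≢σt refl with trans (sym (answered t bt)) (proj₁ legal)
        ... | ()

      fixed₂ : ∀ t → σ t ≡ t → b₂ t ≢ nothing
      fixed₂ t eq bt = fixed t eq (proj₂ (proj₂ (nothing₂⁻ t bt)))

  -- The list `L` only bounds the empty squares from above and supplies the termination measure:
  -- filtering out `s` shortens it each round, and it may still contain occupied squares such as
  -- `σ s`.
  mirror-wins-within : ∀ p b (L : List (Square n m)) → Acc _<_ (length L) →
    (∀ t → b t ≡ nothing → t ∈ L) → Mirrored p b → WinsToReply p b
  mirror-wins-within p b L (acc rec) empty∈L inv = reply λ s legal →
    let open Round p b inv s legal
        other? = λ t → ¬? (s ≟□ t)
    in move (σ s) mirror-legal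
         (mirror-wins-within p b₂ (filter other? L)
           (rec (filter-notAll other? L
             (lose (empty∈L s (proj₁ legal)) λ s≢s → s≢s refl)))
           (λ t eq → let _ , s≢t , bt = nothing₂⁻ t eq in
             ∈-filter⁺ other? (empty∈L t bt) s≢t)
           mirrored)

  mirror-wins : ∀ p b → Mirrored p b → WinsToReply p b
  mirror-wins p b = mirror-wins-within p b (cartesianProduct (allFin n) (allFin m))
    (<-wellFounded _)
    (λ (x , y) _ → ∈-cartesianProduct⁺ (∈-allFin x) (∈-allFin y))

-- Reflection of one side, its centre, and parity.

i+suc-opposite≡n : (i : Fin n) → toℕ i + suc (toℕ (opposite i)) ≡ n
i+suc-opposite≡n {n} i = begin
  toℕ i + suc (toℕ (opposite i))  ≡⟨ +-suc (toℕ i) _ ⟩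
  suc (toℕ i) + toℕ (opposite i)  ≡⟨ cong (suc (toℕ i) +_) (opposite-prop i) ⟩
  suc (toℕ i) + _                 ≡⟨ m+[n∸m]≡n (toℕ<n i) ⟩
  n                               ∎
  where open ≡-Reasoning

-- The equation `i+suc-opposite≡n` with `opposite i` replaced by `i`; it amounts to `n = 2i + 1`.
IsCentre : Fin n → Set
IsCentre {n} i = toℕ i + suc (toℕ i) ≡ n

centre⇒fixed : (i : Fin n) → IsCentre i → opposite i ≡ i
centre⇒fixed i eq = toℕ-injective (suc-injective
  (+-cancelˡ-≡ (toℕ i) _ _ (trans (i+suc-opposite≡n i) (sym eq))))

fixed⇒centre : (i : Fin n) → opposite i ≡ i → IsCentre i
fixed⇒centre {n} i eq =
  subst (λ j → toℕ i + suc (toℕ j) ≡ n) eq (i+suc-opposite≡n i)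

k+suck≡suc2k : ∀ k → k + suc k ≡ 2 * k + 1
k+suck≡suc2k = solve-∀

centre-unique : (i j : Fin n) → IsCentre i → IsCentre j → i ≡ j
centre-unique i j eqᵢ eqⱼ = toℕ-injective (*-cancelˡ-≡ _ _ 2
  (+-cancelʳ-≡ 1 _ _ (begin
    2 * toℕ i + 1        ≡⟨ k+suck≡suc2k (toℕ i) ⟨
    toℕ i + suc (toℕ i)  ≡⟨ trans eqᵢ (sym eqⱼ) ⟩
    toℕ j + suc (toℕ j)  ≡⟨ k+suck≡suc2k (toℕ j) ⟩
    2 * toℕ j + 1        ∎)))
  where open ≡-Reasoning

centre⇒odd : (i : Fin n) → IsCentre i → ¬ 2 ∣ n
centre⇒odd i eq 2∣n
  with ∣1⇒≡1 (∣m+n∣m⇒∣n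
         (subst (2 ∣_) (trans (sym eq) (k+suck≡suc2k (toℕ i))) 2∣n)
         (m∣m*n (toℕ i)))
... | ()

even⊎centre : ∀ n → 2 ∣ n ⊎ ∃ λ (i : Fin n) → IsCentre i
even⊎centre zero          = inj₁ (2 ∣0)
even⊎centre (suc zero)    = inj₂ (zero , refl)
even⊎centre (suc (suc n)) with even⊎centre n
... | inj₁ 2∣n      = inj₁ (∣m∣n⇒∣m+n ∣-refl 2∣n)
-- Lengthening the side by two moves the centre up by one; `inject₁` widens the type and keeps the
-- value.
... | inj₂ (i , eq) = inj₂ (suc (inject₁ i) , cong suc (begin
  toℕ (inject₁ i) + suc (suc (toℕ (inject₁ i)))
    ≡⟨ cong (λ k → k + suc (suc k)) (toℕ-inject₁ i) ⟩
  toℕ i + suc (suc (toℕ i))  ≡⟨ +-suc (toℕ i) _ ⟩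
  suc (toℕ i + suc (toℕ i))  ≡⟨ cong suc eq ⟩
  suc n                      ∎))
  where open ≡-Reasoning

-- Consecutive numbers have an odd sum, and `n` is one more than the sum of `i` and `opposite i`.
opposite-adjacent⇒even : (i : Fin n) → toℕ (opposite i) ≡ toℕ i ± 1 → 2 ∣ n
opposite-adjacent⇒even {n} i adj = subst (2 ∣_) (i+suc-opposite≡n i) (even-sum adj)
  where
  up : ∀ k → k + suc (k + 1) ≡ suc k * 2
  up = solve-∀

  down : ∀ k → k + 1 + suc k ≡ suc k * 2
  down = solve-∀

  even-sum : ∀ {j k} → k ≡ j ± 1 → 2 ∣ j + suc k
  even-sum {j} (inj₁ refl)     = divides (suc j) (up j)
  even-sum {k = k} (inj₂ refl) = divides (suc k) (down k)

-- Reflections and knight attacks.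

PreservesDistance : (Fin n → Fin n) → Set
PreservesDistance f =
  ∀ i j d → toℕ j ≡ toℕ i ± d → toℕ (f j) ≡ toℕ (f i) ± d

-- Reflection reverses the order, so `i` and `j` change sides; comparing two expressions for `n` and
-- cancelling avoids subtraction.
opposite-+ : ∀ (i j : Fin n) d → toℕ j ≡ toℕ i + d →
             toℕ (opposite i) ≡ toℕ (opposite j) + d
opposite-+ {n} i j d j≡i+d = suc-injective (+-cancelˡ-≡ (toℕ i) _ _ (begin
  toℕ i + suc (toℕ (opposite i))      ≡⟨ i+suc-opposite≡n i ⟩
  n                                   ≡⟨ i+suc-opposite≡n j ⟨
  toℕ j + suc (toℕ (opposite j))      ≡⟨ cong (_+ suc (toℕ (opposite j))) j≡i+d ⟩
  toℕ i + d + suc (toℕ (opposite j))  ≡⟨ rearrange (toℕ i) d _ ⟩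
  toℕ i + suc (toℕ (opposite j) + d)  ∎))
  where
  open ≡-Reasoning
  rearrange : ∀ a b c → a + b + suc c ≡ a + suc (c + b)
  rearrange = solve-∀

opposite-preservesDistance : PreservesDistance (opposite {n})
opposite-preservesDistance i j d (inj₁ j≡i+d) = inj₂ (opposite-+ i j d j≡i+d)
opposite-preservesDistance i j d (inj₂ i≡j+d) = inj₁ (opposite-+ j i d i≡j+d)

id-preservesDistance : PreservesDistance (id {A = Fin n})
id-preservesDistance _ _ _ eq = eq

map-attacks : ∀ {f : Fin n → Fin n} {g : Fin m → Fin m} →
  PreservesDistance f → PreservesDistance g →
  ∀ s t → Attacks s t → Attacks (map f g s) (map f g t)
map-attacks F G (a , b) (c , d) (inj₁ (p , q)) = inj₁ (F a c 1 p , G b d 2 q)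
map-attacks F G (a , b) (c , d) (inj₂ (p , q)) = inj₂ (F a c 2 p , G b d 1 q)

k≢k±suc : ∀ k d → ¬ (k ≡ k ± suc d)
k≢k±suc k d (inj₁ eq) = m≢1+m+n k (trans eq (+-suc k d))
k≢k±suc k d (inj₂ eq) = m≢1+m+n k (trans eq (+-suc k d))

-- A knight move changes both coordinates, whereas reflecting one side leaves the other coordinate
-- alone.
same-row-peaceful : ∀ {x x′ : Fin n} {y : Fin m} → ¬ Attacks (x , y) (x′ , y)
same-row-peaceful {y = y} (inj₁ (_ , q)) = k≢k±suc (toℕ y) 1 q
same-row-peaceful {y = y} (inj₂ (_ , q)) = k≢k±suc (toℕ y) 0 q

same-column-peaceful : ∀ {x : Fin n} {y y′ : Fin m} → ¬ Attacks (x , y) (x , y′)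
same-column-peaceful {x = x} (inj₁ (p , _)) = k≢k±suc (toℕ x) 0 p
same-column-peaceful {x = x} (inj₂ (p , _)) = k≢k±suc (toℕ x) 1 p

-- Every knight move changes one coordinate by exactly 1, but on an odd side
-- i and opposite i differ by an even number.
half-turn-peaceful : ¬ 2 ∣ n → ¬ 2 ∣ m →
  ∀ (s : Square n m) → ¬ Attacks s (map opposite opposite s)
half-turn-peaceful n-odd m-odd (x , _) (inj₁ (p , _)) =
  n-odd (opposite-adjacent⇒even x p)
half-turn-peaceful n-odd m-odd (_ , y) (inj₂ (_ , q)) =
  m-odd (opposite-adjacent⇒even y q)

-- The strategies for an even side and for two odd sides.

even-width⇒secondWins : 2 ∣ n → SecondPlayerWins n m
even-width⇒secondWins {n} {m} 2∣n = mirror-wins black emptyBoard record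
  { empty    = λ _ _ → refl
  ; answered = λ _ ()
  ; fixed    = λ (x , _) eq _ →
      centre⇒odd x (fixed⇒centre x (cong proj₁ eq)) 2∣n
  }
  where
  open Mirroring {n} {m} (map opposite id)
    (λ (x , y) → cong (_, y) (opposite-involutive x))
    (map-attacks opposite-preservesDistance id-preservesDistance)
    (λ (x , y) → same-row-peaceful {x = x} {x′ = opposite x} {y = y})

even-height⇒secondWins : 2 ∣ m → SecondPlayerWins n m
even-height⇒secondWins {m} {n} 2∣m = mirror-wins black emptyBoard record
  { empty    = λ _ _ → refl
  ; answered = λ _ ()
  ; fixed    = λ (_ , y) eq _ →
      centre⇒odd y (fixed⇒centre y (cong proj₂ eq)) 2∣m
  }
  where
  open Mirroring {n} {m} (map id opposite)
    (λ (x , y) → cong (x ,_) (opposite-involutive y))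
    (map-attacks id-preservesDistance opposite-preservesDistance)
    (λ (x , y) → same-column-peaceful {x = x} {y = y} {y′ = opposite y})

centres⇒firstWins : ∀ {i : Fin n} {j : Fin m} → IsCentre i → IsCentre j →
                    WinsToMove white (emptyBoard {n} {m})
centres⇒firstWins {n} {m} {i} {j} i-centre j-centre =
  move c (refl , λ _ ()) (mirror-wins white (place white c emptyBoard) record
    { empty    = λ t eq →
        -- The centre is its own image, so `σ t` can equal `c` only when `t` does, and `c` is
        -- occupied.
        let c≢t , _ = place-nothing⁻ white c t emptyBoard eq
        in place-other white emptyBoard λ c≡σt →
             c≢t (σ-injective (trans σc≡c c≡σt))
    ; answered = answered
    ; fixed    = λ t σt≡t eq →
        proj₁ (place-nothing⁻ white c t emptyBoard eq) (fixed⇒c t σt≡t)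
    })
  where
  c : Square n m
  c = i , j

  open Mirroring {n} {m} (map opposite opposite)
    (λ (x , y) → cong₂ _,_ (opposite-involutive x) (opposite-involutive y))
    (map-attacks opposite-preservesDistance opposite-preservesDistance)
    (half-turn-peaceful (centre⇒odd i i-centre) (centre⇒odd j j-centre))

  σc≡c : map opposite opposite c ≡ c
  σc≡c = cong₂ _,_ (centre⇒fixed i i-centre) (centre⇒fixed j j-centre)

  fixed⇒c : ∀ t → map opposite opposite t ≡ t → c ≡ t
  fixed⇒c (x , y) eq = cong₂ _,_
    (centre-unique i x i-centre (fixed⇒centre x (cong proj₁ eq)))
    (centre-unique j y j-centre (fixed⇒centre y (cong proj₂ eq)))

  answered : ∀ t → place white c emptyBoard t ≡ just black →
             place white c emptyBoard (map opposite opposite t) ≡ just white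
  -- The only knight on the board is white, so there is no black knight to answer.
  answered t eq with place-just⁻ white c t emptyBoard eq
  ... | inj₁ (_ , ())
  ... | inj₂ (_ , ())

theorem5p2 : (n m : ℕ) → .{{_ : NonZero n}} → .{{_ : NonZero m}} →
    SecondPlayerWins n m ⇔ (2 ∣ n ⊎ 2 ∣ m)
theorem5p2 n m = mk⇔ to λ where
    (inj₁ 2∣n) → even-width⇒secondWins 2∣n
    (inj₂ 2∣m) → even-height⇒secondWins 2∣m
  where
  to : SecondPlayerWins n m → 2 ∣ n ⊎ 2 ∣ m
  to second with even⊎centre n | even⊎centre m
  ... | inj₁ 2∣n     | _            = inj₁ 2∣n
  ... | inj₂ _       | inj₁ 2∣m     = inj₂ 2∣m
  -- Both sides have a centre, so white wins by the half-turn, contradicting black's strategy.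
  ... | inj₂ (_ , p) | inj₂ (_ , q) =
    ⊥-elim (exclusive white (centres⇒firstWins p q) second)
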